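{- If the natural number exo-type $\mathbb N^e$ is cofibrant, then the exo-type $\mathsf{UnLBinTree}^e$ of unlabeled binary exo-trees is both cofibrant and sharp.
   Context: Setting: two-level type theory (2LTT). There is a hierarchy of universes $\mathcal U$ whose terms are called types and which obeys homotopy type theory (with the usual $\prod,\sum,+,\mathbf 1,\mathbf 0,\mathbb N$ and identity type $=$), and a hierarchy of exo-universes $\mathcal U^e$ whose terms are called exo-types, with their own formers $\prod^e,\sum^e,+^e,\mathbf 1^e,\mathbf 0^e,\mathbb N^e$ and exo-equality $=^e$. Every type is also an exo-type. Exo-level inductive exo-types eliminate into arbitrary exo-types, while inductive types eliminate only into types. Axioms: univalence (hence function extensionality) for $=$; function extensionality and uniqueness of identity proofs for $=^e$. An exo-isomorphism $A\cong B$ of exo-types consists of $f:A\to B$, $g:B\to A$ with $f\circ g=^e\mathrm{id}_B$ and $g\circ f=^e\mathrm{id}_A$. An exo-type $A$ is fibrant if there is a type $RA:\mathcal U$ (its fibrant match) with $A\cong RA$. An exo-type $A$ is cofibrant if (1) for any $Y:A\to\mathcal U$ the exo-type $\prod^e_{a:A}Y(a)$ is fibrant, and (2) in that case, if each $Y(a)$ is contractible (with respect to $=$), then so is the fibrant match of $\prod^e_{a:A}Y(a)$. If $A,B$ are fibrant exo-types with exo-isomorphisms $s_A:RA\to A$ and $r_B:B\to RB$ ($RA,RB:\mathcal U$), a map $f:A\to B$ is a fibrant-equivalence if $r_B\circ f\circ s_A:RA\to RB$ is an equivalence of types. An exo-type $A$ is sharp if it is cofibrant and there are a type $RA:\mathcal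 U$ and a map $r:A\to RA$ such that for any $Y:RA\to\mathcal U$ the precomposition map $(-\circ r):\prod_{c:RA}Y(c)\to\prod^e_{a:A}Y(r(a))$ is a fibrant-equivalence. $\mathsf{UnLBinTree}^e:\mathcal U^e$ is the inductive exo-type with constructors $\mathsf{u\text{ - }leaf}^e:\mathsf{UnLBinTree}^e$ and $\mathsf{u\text{ - }node}^e:\mathsf{UnLBinTree}^e\to\mathsf{UnLBinTree}^e\to\mathsf{UnLBinTree}^e$. -}

{-# OPTIONS --with-K #-}
module Defs where

open import Level using (Level; Setω; _⊔_) renaming (zero to lzero; suc to lsuc)
open import Axiom.Extensionality.Propositional using (Extensionality)
open import Data.Nat.Base using (ℕ)
open import Data.Product.Base using (Σ; _,_)
open import Data.Unit.Base using (⊤)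
open import Function.Base using (id; _∘_)
open import Relation.Binary.PropositionalEquality.Core using (_≡_; refl; sym; cong; subst)

-- The outer level of two-level type theory is Agda itself: Set i is the i-th
-- exo-universe, the exo-type formers are those of Agda and of the standard
-- library (so ℕ below is the exo-natural numbers), and exo-equality is _≡_,
-- whose uniqueness of identity proofs is provable because of --with-K.
-- The inner level is an arbitrary cumulative hierarchy of universes à la Tarski:
-- a type is some A : U i, and El A is the same type regarded as an exo-type.

infix 4 _≅_

record _≅_ {i j} (A : Set i) (B : Set j) : Set (i ⊔ j) where
  field
    to      : A → B
    from    : B → A
    to∘from : to ∘ from ≡ id
    from∘to : from ∘ to ≡ id

open _≅_ public

≅-refl : ∀ {i} {A : Set i} → A ≅ A
≅-refl = record { to = id ; from = id ; to∘from = refl ; from∘to = refl }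

-- Judgmental equalities of the inner theory are rendered as exo-equalities.
-- The formers Π, Σ and 𝟙, which have an η-rule, then agree with their exo
-- counterparts up to exo-isomorphism; the other formers are inductive and
-- eliminate only into types.  Sg is the inner ∑.

record TwoLevelTypeTheory : Setω where
  infixr 4 _⇒_
  infixr 3 _⊕_

  field
    U  : (i : Level) → Set (lsuc i)
    El : ∀ {i} → U i → Set i

    𝓤    : (i : Level) → U (lsuc i)
    El-𝓤 : ∀ i → El (𝓤 i) ≅ U i

    Lift    : ∀ {i} (j : Level) → U i → U (i ⊔ j)
    El-Lift : ∀ {i} (j : Level) (A : U i) → El (Lift j A) ≅ El A

    Π    : ∀ {i j} (A : U i) → (El A → U j) → U (i ⊔ j)
    El-Π : ∀ {i j} (A : U i) (B : El A → U j) →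
           El (Π A B) ≅ ((a : El A) → El (B a))

    Sg    : ∀ {i j} (A : U i) → (El A → U j) → U (i ⊔ j)
    El-Sg : ∀ {i j} (A : U i) (B : El A → U j) →
            El (Sg A B) ≅ Σ (El A) (λ a → El (B a))

    𝟙    : U lzero
    El-𝟙 : El 𝟙 ≅ ⊤

    𝟘      : U lzero
    𝟘-elim : ∀ {j} (P : El 𝟘 → U j) → (x : El 𝟘) → El (P x)

    _⊕_    : ∀ {i j} → U i → U j → U (i ⊔ j)
    inl    : ∀ {i j} {A : U i} {B : U j} → El A → El (A ⊕ B)
    inr    : ∀ {i j} {A : U i} {B : U j} → El B → El (A ⊕ B)
    ⊕-elim : ∀ {i j k} {A : U i} {B : U j} (P : El (A ⊕ B) → U k) →
             (∀ a → El (P (inl a))) → (∀ b → El (P (inr b))) →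
             ∀ x → El (P x)
    ⊕-inl  : ∀ {i j k} {A : U i} {B : U j} (P : El (A ⊕ B) → U k)
             (f : ∀ a → El (P (inl a))) (g : ∀ b → El (P (inr b))) →
             ∀ a → ⊕-elim P f g (inl a) ≡ f a
    ⊕-inr  : ∀ {i j k} {A : U i} {B : U j} (P : El (A ⊕ B) → U k)
             (f : ∀ a → El (P (inl a))) (g : ∀ b → El (P (inr b))) →
             ∀ b → ⊕-elim P f g (inr b) ≡ g b

    N       : U lzero
    zeroᴺ   : El N
    sucᴺ    : El N → El N
    N-elim  : ∀ {j} (P : El N → U j) → El (P zeroᴺ) →
              (∀ n → El (P n) → El (P (sucᴺ n))) → ∀ n → El (P n)
    N-zero  : ∀ {j} (P : El N → U j) (z : El (P zeroᴺ))
              (s : ∀ n → El (P n) → El (P (sucᴺ n))) →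
              N-elim P z s zeroᴺ ≡ z
    N-suc   : ∀ {j} (P : El N → U j) (z : El (P zeroᴺ))
              (s : ∀ n → El (P n) → El (P (sucᴺ n))) →
              ∀ n → N-elim P z s (sucᴺ n) ≡ s n (N-elim P z s n)

    Id      : ∀ {i} (A : U i) → El A → El A → U i
    idp     : ∀ {i} {A : U i} (a : El A) → El (Id A a a)
    J       : ∀ {i j} {A : U i} {a : El A} (P : ∀ x → El (Id A a x) → U j) →
              El (P a (idp a)) → ∀ {x} (p : El (Id A a x)) → El (P x p)
    J-idp   : ∀ {i j} {A : U i} {a : El A} (P : ∀ x → El (Id A a x) → U j)
              (d : El (P a (idp a))) → J P d (idp a) ≡ d

  _⇒_ : ∀ {i j} → U i → U j → U (i ⊔ j)
  A ⇒ B = Π A (λ _ → B)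

  app : ∀ {i j} {A : U i} {B : El A → U j} → El (Π A B) → (a : El A) → El (B a)
  app {A = A} {B} = to (El-Π A B)

  lam : ∀ {i j} {A : U i} {B : El A → U j} → ((a : El A) → El (B a)) → El (Π A B)
  lam {A = A} {B} = from (El-Π A B)

  pair : ∀ {i j} {A : U i} {B : El A → U j} (a : El A) → El (B a) → El (Sg A B)
  pair {A = A} {B} a b = from (El-Sg A B) (a , b)

  isContr : ∀ {i} → U i → U i
  isContr A = Sg A (λ a → Π A (λ x → Id A a x))

  fib : ∀ {i j} {A : U i} {B : U j} → (El A → El B) → El B → U (i ⊔ j)
  fib {A = A} {B} f b = Sg A (λ a → Id B (f a) b)

  isEquiv : ∀ {i j} {A : U i} {B : U j} → (El A → El B) → U (i ⊔ j)
  isEquiv {B = B} f = Π B (λ b → isContr (fib f b))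

  _≃_ : ∀ {i j} → U i → U j → U (i ⊔ j)
  A ≃ B = Sg (A ⇒ B) (λ f → isEquiv (app f))

  equiv : ∀ {i j} {A : U i} {B : U j} (f : El A → El B) → El (isEquiv f) → El (A ≃ B)
  equiv {A = A} {B} f e =
    pair (lam f)
      (subst (λ g → El (isEquiv g)) (sym (cong (λ h → h f) (to∘from (El-Π A (λ _ → B))))) e)

  id-fib-contr : ∀ {i} (A : U i) {a b : El A} (p : El (Id A a b)) →
                 El (Id (fib id b) (pair b (idp b)) (pair a p))
  id-fib-contr A {a} =
    J (λ b p → Id (fib id b) (pair b (idp b)) (pair a p)) (idp (pair a (idp a)))

  id-isEquiv : ∀ {i} (A : U i) → El (isEquiv {A = A} id)
  id-isEquiv A = lam λ b → pair (pair b (idp b)) (lam λ x →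
    subst (λ y → El (Id (fib id b) (pair b (idp b)) y))
          (cong (λ h → h x) (from∘to (El-Sg A (λ a → Id A a b))))
          (id-fib-contr A _))

  decode : ∀ {i} → El (𝓤 i) → U i
  decode {i} = to (El-𝓤 i)

  idtoeqv : ∀ {i} {X Y : El (𝓤 i)} → El (Id (𝓤 i) X Y) → El (decode X ≃ decode Y)
  idtoeqv {X = X} =
    J (λ Y _ → decode X ≃ decode Y) (equiv id (id-isEquiv (decode X)))

  -- Inner function extensionality is a consequence of univalence and is not
  -- assumed separately.
  field
    univalence : ∀ {i} (X Y : El (𝓤 i)) →
                 El (isEquiv {A = Id (𝓤 i) X Y} {B = decode X ≃ decode Y} idtoeqv)
    funextᵉ    : ∀ {i j} → Extensionality i j

module _ (T : TwoLevelTypeTheory) where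
  open TwoLevelTypeTheory T

  -- As in the inner hierarchy itself, an exo-type in the i-th exo-universe has
  -- its fibrant match in U i; families Y range over all universes U j.
  record IsFibrant {i} (A : Set i) : Set (lsuc i) where
    field
      match : U i
      iso   : A ≅ El match

  open IsFibrant

  record IsCofibrant {i} (A : Set i) : Setω where
    field
      Π-fibrant : ∀ {j} (Y : A → U j) → IsFibrant ((a : A) → El (Y a))
      Π-contr   : ∀ {j} (Y : A → U j) → (∀ a → El (isContr (Y a))) →
                  El (isContr (match (Π-fibrant Y)))

  open IsCofibrant

  type-fibrant : ∀ {i} (A : U i) → IsFibrant (El A)
  type-fibrant A = record { match = A ; iso = ≅-refl }

  IsFibrantEquiv : ∀ {i j} {A : Set i} {B : Set j} →
                   IsFibrant A → IsFibrant B → (A → B) → Set (i ⊔ j)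
  IsFibrantEquiv FA FB f =
    El (isEquiv {A = match FA} {B = match FB} (to (iso FB) ∘ f ∘ from (iso FA)))

  precomp : ∀ {i j} {A : Set i} {C : U i} (r : A → El C) (Y : El C → U j) →
            El (Π C Y) → (a : A) → El (Y (r a))
  precomp r Y g a = app g (r a)

  record IsSharp {i} (A : Set i) : Setω where
    field
      cofibrant     : IsCofibrant A
      RA            : U i
      r             : A → El RA
      precomp-equiv : ∀ {j} (Y : El RA → U j) →
                      IsFibrantEquiv (type-fibrant (Π RA Y)) (Π-fibrant cofibrant (λ a → Y (r a)))
                                     (precomp r Y)

data UnLBinTreeᵉ : Set where
  u-leafᵉ : UnLBinTreeᵉ
  u-nodeᵉ : UnLBinTreeᵉ → UnLBinTreeᵉ → UnLBinTreeᵉ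

record _×ω_ (P Q : Setω) : Setω where
  constructor _,ω_
  field
    proj₁ω : P
    proj₂ω : Q

{-# OPTIONS --safe #-}
module Submission where

-- Cantor's pairing makes the exo-type of trees exo-isomorphic to ℕ, and both
-- cofibrancy and sharpness transfer along exo-isomorphisms, so it suffices that ℕ
-- is sharp when it is cofibrant.  Its comparison map is ι : ℕ → El N.  Restriction
-- along ι has a strict section, which extends an exo-sequence to a section over N
-- by inner induction; that extending a restriction gives back the original
-- section holds pointwise by inner induction, hence by function extensionality,
-- which is derived from univalence.

open import Data.Nat.Base using (ℕ; zero; suc; _+_; _≤_; _<_; z≤n; s≤s)
open import Data.Nat.Induction using (<-rec)
open import Data.Nat.Properties
  using (+-suc; +-identityʳ; +-comm; suc-injective; ≤-trans; m≤m+n; m≤n+m)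
open import Data.Product.Base using (Σ; ∃; ∃₂; _×_; _,_; proj₁; proj₂)
open import Function.Base using (id; _∘_; const)
open import Level using (Level; _⊔_)
open import Relation.Binary.PropositionalEquality.Core
  using (_≡_; refl; sym; trans; cong; cong-app; subst)
open import Defs

-- Cantor's pairing function.

triangle : ℕ → ℕ
triangle zero    = zero
triangle (suc n) = suc n + triangle n

cantor : ℕ → ℕ → ℕ
cantor a b = triangle (a + b) + b

cantor-suc : ∀ a b → cantor a (suc b) ≡ suc (cantor (suc a) b)
cantor-suc a b rewrite +-suc a b = +-suc (suc (a + b) + triangle (a + b)) b

cantor-wrap : ∀ b → cantor (suc b) 0 ≡ suc (cantor 0 b)
cantor-wrap b rewrite +-identityʳ b | +-identityʳ (b + triangle b) =
  cong suc (+-comm b (triangle b))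

-- One step of the walk along the antidiagonals: down from `(n , 0)` to `(0 , n)`, then on to
-- `(n + 1 , 0)`.
next : ℕ × ℕ → ℕ × ℕ
next (zero  , b) = suc b , zero
next (suc a , b) = a , suc b

uncantor : ℕ → ℕ × ℕ
uncantor zero    = zero , zero
uncantor (suc n) = next (uncantor n)

-- Induction on `n`: the two recurrences for `cantor` exhibit the pair as `next` of the pair coded
-- by the predecessor. Pairing is therefore injective.
uncantor-unique : ∀ n a b → cantor a b ≡ n → uncantor n ≡ (a , b)
uncantor-unique zero    zero    zero    _ = refl
-- `cantor a (suc b)` is stuck on `a`; only `cantor-suc` exposes the successor that contradicts
-- zero.
uncantor-unique zero    a       (suc b) e with () ← trans (sym (cantor-suc a b)) e
uncantor-unique (suc n) a       (suc b) e =
  cong next (uncantor-unique n (suc a) b (suc-injective (trans (sym (cantor-suc a b)) e)))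
uncantor-unique (suc n) (suc a) zero    e =
  cong next (uncantor-unique n zero a (suc-injective (trans (sym (cantor-wrap a)) e)))

cantor-surjective : ∀ n → ∃₂ λ a b → cantor a b ≡ n
cantor-surjective zero    = zero , zero , refl
cantor-surjective (suc n) with cantor-surjective n
... | zero  , b , e = suc b , zero , trans (cantor-wrap b) (cong suc e)
... | suc a , b , e = a , suc b , trans (cantor-suc a b) (cong suc e)

n≤triangle : ∀ n → n ≤ triangle n
n≤triangle zero    = z≤n
n≤triangle (suc n) = m≤m+n (suc n) (triangle n)

-- With the `suc` in `encode`, these bounds put the codes of both subtrees strictly below that of
-- the tree.
fst≤cantor : ∀ a b → a ≤ cantor a b
fst≤cantor a b = ≤-trans (m≤m+n a b) (≤-trans (n≤triangle (a + b)) (m≤m+n _ b))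

snd≤cantor : ∀ a b → b ≤ cantor a b
snd≤cantor a b = m≤n+m b _

-- Coding trees by natural numbers.

encode : UnLBinTreeᵉ → ℕ
encode u-leafᵉ       = zero
encode (u-nodeᵉ l r) = suc (cantor (encode l) (encode r))

encode-injective : ∀ s t → encode s ≡ encode t → s ≡ t
encode-injective u-leafᵉ       u-leafᵉ         _ = refl
encode-injective (u-nodeᵉ l r) (u-nodeᵉ l′ r′) e
  with p ← trans (sym (uncantor-unique _ _ _ (suc-injective e))) (uncantor-unique _ _ _ refl)
  with refl ← encode-injective l l′ (cong proj₁ p)
  with refl ← encode-injective r r′ (cong proj₂ p) = refl

-- Strong induction: unpairing the predecessor of `n` gives two smaller codes, which decode to the
-- two subtrees.
encode-surjective : ∀ n → ∃ λ t → encode t ≡ n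
encode-surjective = <-rec (λ n → ∃ λ t → encode t ≡ n) step
  where
  step : ∀ n → (∀ {m} → m < n → ∃ λ t → encode t ≡ m) → ∃ λ t → encode t ≡ n
  step zero    rec = u-leafᵉ , refl
  step (suc n) rec with cantor-surjective n
  ... | a , b , refl with rec (s≤s (fst≤cantor a b)) | rec (s≤s (snd≤cantor a b))
  ...   | l , refl | r , refl = u-nodeᵉ l r , refl

module _ (T : TwoLevelTypeTheory) where
  open TwoLevelTypeTheory T
  open IsFibrant
  open IsCofibrant
  open IsSharp

  private variable
    i j k : Level

  tree≅ℕ : UnLBinTreeᵉ ≅ ℕ
  tree≅ℕ = record
    { to      = encode
    ; from    = λ n → proj₁ (encode-surjective n)
    ; to∘from = funextᵉ λ n → proj₂ (encode-surjective n)
    ; from∘to = funextᵉ λ t → encode-injective _ t (proj₂ (encode-surjective (encode t)))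
    }

  -- Inner products, sums and identity types.

  app-lam : {A : U i} {B : El A → U j} (f : ∀ a → El (B a)) → app {A = A} {B} (lam f) ≡ f
  app-lam {A = A} {B} f = cong-app (to∘from (El-Π A B)) f

  lam-app : {A : U i} {B : El A → U j} (g : El (Π A B)) → lam (app g) ≡ g
  lam-app {A = A} {B} g = cong-app (from∘to (El-Π A B)) g

  fst : {A : U i} {B : El A → U j} → El (Sg A B) → El A
  fst {A = A} {B} w = proj₁ (to (El-Sg A B) w)

  snd : {A : U i} {B : El A → U j} (w : El (Sg A B)) → El (B (fst w))
  snd {A = A} {B} w = proj₂ (to (El-Sg A B) w)

  fst-pair : {A : U i} {B : El A → U j} (a : El A) (b : El (B a)) →
             fst {B = B} (pair a b) ≡ a
  fst-pair {A = A} {B} a b = cong proj₁ (cong-app (to∘from (El-Sg A B)) (a , b))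

  Sg-elim : {A : U i} {B : El A → U j} (P : El (Sg A B) → U k) →
            (∀ a b → El (P (pair a b))) → ∀ w → El (P w)
  Sg-elim {A = A} {B} P f w =
    subst (El ∘ P) (cong-app (from∘to (El-Sg A B)) w) (f (fst w) (snd w))

  -- Once the projections of `pair a b` are computed, the exo-equality transported along is a loop,
  -- hence `refl` by uniqueness of identity proofs. `aux` frees its endpoint so that matching can
  -- see this.
  Sg-elim-pair : {A : U i} {B : El A → U j} (P : El (Sg A B) → U k)
                 (f : ∀ a b → El (P (pair a b))) → ∀ a b → Sg-elim P f (pair a b) ≡ f a b
  Sg-elim-pair {A = A} {B} P f a b =
    aux (cong-app (to∘from (El-Sg A B)) (a , b)) _
    where
    aux : ∀ {v} → v ≡ (a , b) → (q : from (El-Sg A B) v ≡ pair a b) →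
          subst (El ∘ P) q (f (proj₁ v) (proj₂ v)) ≡ f a b
    aux refl refl = refl

  transport : {A : U i} (P : El A → U j) {a b : El A} → El (Id A a b) → El (P a) → El (P b)
  transport P p u = J (λ x _ → P x) u p

  ap : {A : U i} {B : U j} (f : El A → El B) {a b : El A} →
       El (Id A a b) → El (Id B (f a) (f b))
  ap {B = B} f {a} = J (λ x _ → Id B (f a) (f x)) (idp (f a))

  Id-sym : {A : U i} {a b : El A} → El (Id A a b) → El (Id A b a)
  Id-sym {A = A} {a} = J (λ x _ → Id A x a) (idp a)

  Id-trans : {A : U i} {a b c : El A} → El (Id A a b) → El (Id A b c) → El (Id A a c)
  Id-trans {A = A} {a} p q = transport (Id A a) q p

  ≡⇒Id : {A : U i} {a b : El A} → a ≡ b → El (Id A a b)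
  ≡⇒Id refl = idp _

  -- Contractible types and equivalences.

  mkContr : {A : U i} (c : El A) → (∀ x → El (Id A c x)) → El (isContr A)
  mkContr c p = pair c (lam p)

  centre : {A : U i} → El (isContr A) → El A
  centre = fst

  contraction : {A : U i} (c : El (isContr A)) (x : El A) → El (Id A (centre c) x)
  contraction c = app (snd c)

  contr⇒Id : {A : U i} → El (isContr A) → ∀ x y → El (Id A x y)
  contr⇒Id c x y = Id-trans (Id-sym (contraction c x)) (contraction c y)

  contr-retract : {A : U i} {B : U j} (s : El A → El B) (r : El B → El A) →
                  (∀ a → El (Id A (r (s a)) a)) → El (isContr B) → El (isContr A)
  contr-retract s r e c =
    mkContr (r (centre c)) λ a → Id-trans (ap r (contraction c (s a))) (e a)

  equiv-inverse : {A : U i} {B : U j} (f : El A → El B) → El (isEquiv {A = A} {B} f) →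
                  ∀ b → El (fib {A = A} {B} f b)
  equiv-inverse f e b = centre (app e b)

  -- Both `x` with `p` and `y` with `idp` lie in the contractible fibre over `f y`; identifying them
  -- identifies their first components.
  equiv-injective : {A : U i} {B : U j} (f : El A → El B) → El (isEquiv {A = A} {B} f) →
                    ∀ {x y} → El (Id B (f x) (f y)) → El (Id A x y)
  equiv-injective {A = A} {B} f e {x} {y} p =
    subst (λ z → El (Id A z y)) (fst-pair x p)
      (subst (λ z → El (Id A (fst (pair {B = F} x p)) z)) (fst-pair {B = F} y (idp (f y)))
        (ap fst (contr⇒Id (app e (f y)) (pair x p) (pair y (idp (f y))))))
    where
    F : El A → U _
    F a = Id B (f a) (f y)

  -- Function extensionality from univalence.

  code : U i → El (𝓤 i)
  code {i} = from (El-𝓤 i)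

  decode-code : (A : U i) → decode (code A) ≡ A
  decode-code {i} A = cong-app (to∘from (El-𝓤 i)) A

  -- By univalence `e` comes from an identification, and path induction leaves only `idp`, where
  -- precomposition is exo-equal to the identity by η.
  precomp-isEquiv-code :
    {X Y : El (𝓤 i)} (C : U k) (e : El (decode X ≃ decode Y)) →
    El (isEquiv {A = decode Y ⇒ C} {B = decode X ⇒ C} (λ u → lam (app u ∘ app (fst e))))
  precomp-isEquiv-code {i} {k} {X} {Y} C e =
    transport (Q Y) (snd v) (J (λ Y p → Q Y (idtoeqv p)) base (fst v))
    where
    Q : ∀ Y → El (decode X ≃ decode Y) → U (i ⊔ k)
    Q Y e = isEquiv {A = decode Y ⇒ C} {B = decode X ⇒ C} (λ u → lam (app u ∘ app (fst e)))

    v : El (fib idtoeqv e)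
    v = equiv-inverse idtoeqv (univalence X Y) e

    app-fst-idtoeqv-idp : app (fst (idtoeqv (idp X))) ≡ id
    app-fst-idtoeqv-idp = trans (cong (app ∘ fst) (J-idp _ _))
                         (trans (cong app (fst-pair _ _)) (app-lam id))

    base : El (Q X (idtoeqv (idp X)))
    base = subst (λ f → El (isEquiv {A = decode X ⇒ C} {B = decode X ⇒ C} f))
      (sym (trans (cong (λ f u → lam (app u ∘ f)) app-fst-idtoeqv-idp) (funextᵉ lam-app)))
      (id-isEquiv _)

  precomp-isEquiv :
    {A B : U i} (C : U k) (f : El A → El B) → El (isEquiv {A = A} {B} f) →
    El (isEquiv {A = B ⇒ C} {B = A ⇒ C} (λ u → lam (app u ∘ f)))
  precomp-isEquiv {i} {k} {A} {B} C f e =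
    subst (λ h → El (isEquiv {A = B ⇒ C} {B = A ⇒ C} (λ u → lam (app u ∘ h))))
      (trans (cong app (fst-pair _ _)) (app-lam f))
      (≃-precomp (decode-code A) (decode-code B) (equiv f e))
    where
    -- With `A` and `B` as variables, the exo-equalities `decode-code` can be eliminated by
    -- matching.
    ≃-precomp : ∀ {A B} {X Y : El (𝓤 i)} → decode X ≡ A → decode Y ≡ B → (e : El (A ≃ B)) →
                El (isEquiv {A = B ⇒ C} {B = A ⇒ C} (λ u → lam (app u ∘ app (fst e))))
    ≃-precomp refl refl = precomp-isEquiv-code C

  PathSpace : U i → U i
  PathSpace B = Sg B λ x → Sg B λ y → Id B x y

  path : {B : U i} {x y : El B} → El (Id B x y) → El (PathSpace B)
  path {x = x} {y} p = pair x (pair y p)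

  source target : {B : U i} → El (PathSpace B) → El B
  source = fst
  target = fst ∘ snd

  source-path : {B : U i} {x y : El B} (p : El (Id B x y)) → source (path p) ≡ x
  source-path p = fst-pair _ _

  target-path : {B : U i} {x y : El B} (p : El (Id B x y)) → target (path p) ≡ y
  target-path {B = B} {x} {y} p =
    trans (aux (cong-app (to∘from (El-Sg B S)) (x , pair y p))) (fst-pair y p)
    where
    S : El B → U _
    S x = Sg B (Id B x)

    aux : {v : Σ (El B) (El ∘ S)} → v ≡ (x , pair y p) → fst (proj₂ v) ≡ fst (pair {B = Id B x} y p)
    aux refl = refl

  diagonal : {B : U i} → El B → El (PathSpace B)
  diagonal x = path (idp x)

  -- Path induction shrinks every path to a constant one. Contracting the fibre also requires the
  -- value of the chosen centre on constant paths, computed in `c-diagonal`.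
  diagonal-isEquiv : (B : U i) → El (isEquiv {A = B} {PathSpace B} diagonal)
  diagonal-isEquiv {i} B = lam λ w → mkContr (c w) (Sg-elim (λ v → Id (fib diagonal w) (c w) v)
    λ z → J (λ w q → Id (fib diagonal w) (c w) (pair z q)) (≡⇒Id (c-diagonal z)))
    where
    F : El (PathSpace B) → U i
    F = fib diagonal

    c-path : ∀ x y → (p : El (Id B x y)) → El (F (path p))
    c-path x y = J (λ y p → F (path p)) (pair x (idp (diagonal x)))

    c-pair : ∀ x v → El (F (pair x v))
    c-pair x = Sg-elim (λ v → F (pair x v)) (c-path x)

    c : ∀ w → El (F w)
    c = Sg-elim F c-pair

    c-diagonal : ∀ z → c (diagonal z) ≡ pair z (idp (diagonal z))
    c-diagonal z = trans (Sg-elim-pair F c-pair z _) 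
      (trans (Sg-elim-pair (λ v → F (pair z v)) (c-path z) z _) (J-idp (λ y p → F (path p)) _))

  -- Both maps become the identity after precomposition with `diagonal`, and that precomposition is
  -- injective because `diagonal` is an equivalence.
  source-target : (B : U i) → El (Id (PathSpace B ⇒ B) (lam source) (lam target))
  source-target B = equiv-injective _ (precomp-isEquiv B diagonal (diagonal-isEquiv B))
    (≡⇒Id (cong lam (funextᵉ λ x →
      trans (cong-app (app-lam source) _) (trans (source-path (idp x))
      (sym (trans (cong-app (app-lam target) _) (target-path (idp x))))))))

  -- The homotopy `h` is a single map from `A` to `PathSpace B`; composing with it carries `source`
  -- to `f` and `target` to `g`.
  funext-nondep : {A : U i} {B : U j} {f g : El A → El B} →
                  (∀ a → El (Id B (f a) (g a))) → El (Id (A ⇒ B) (lam f) (lam g))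
  funext-nondep {A = A} {B} {f} {g} h =
    subst (λ u → El (Id (A ⇒ B) u (lam g)))
      (cong lam (funextᵉ λ a → trans (cong-app (app-lam source) _) (source-path (h a))))
      (subst (λ u → El (Id (A ⇒ B) (whisker (lam source)) u))
        (cong lam (funextᵉ λ a → trans (cong-app (app-lam target) _) (target-path (h a))))
        (ap whisker (source-target B)))
    where
    whisker : El (PathSpace B ⇒ B) → El (A ⇒ B)
    whisker u = lam λ a → app u (path (h a))

  Unit : ∀ j → U j
  Unit j = Lift j 𝟙

  ⋆ : El (Unit j)
  ⋆ {j} = from (El-Lift j 𝟙) (from El-𝟙 _)

  Unit-η : (u : El (Unit j)) → ⋆ ≡ u
  Unit-η {j} u = trans (cong (from (El-Lift j 𝟙)) (cong-app (from∘to El-𝟙) _))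
                       (cong-app (from∘to (El-Lift j 𝟙)) u)

  Unit-isEquiv : {A : U j} → El (isContr A) → El (isEquiv {A = A} {Unit j} (const ⋆))
  Unit-isEquiv {j} {A} c = lam λ u → mkContr (v u) (Sg-elim (λ w → Id (F u) (v u) w)
    λ a → J (λ u p → Id (F u) (v u) (pair a p))
      -- The exo-equality `Unit-η ⋆` is a loop, hence `refl`, so the centre over `⋆` carries
      -- `idp ⋆`.
      (subst (λ q → El (Id (F ⋆) (pair (centre c) q) (pair a (idp ⋆)))) (idp-η (Unit-η ⋆))
        (ap (λ x → pair x (idp ⋆)) (contraction c a))))
    where
    F : El (Unit j) → U j
    F = fib {A = A} (const ⋆)

    v : ∀ u → El (F u)
    v u = pair (centre c) (≡⇒Id (Unit-η u))

    idp-η : (q : ⋆ ≡ ⋆) → idp ⋆ ≡ ≡⇒Id q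
    idp-η refl = refl

  contr⇒Id-Unit : {A : U j} → El (isContr A) → El (Id (𝓤 j) (code (Unit j)) (code A))
  contr⇒Id-Unit {j} {A} c = Id-sym (fst (equiv-inverse idtoeqv (univalence _ _) e))
    where
    e : El (decode (code A) ≃ decode (code (Unit j)))
    e rewrite decode-code A | decode-code (Unit j) = equiv (const ⋆) (Unit-isEquiv c)

  -- By univalence a family of contractible types is the constant family at the
  -- unit type, for which the claim holds by η.
  funext-weak : {A : U i} {B : El A → U j} →
                (∀ a → El (isContr (B a))) → El (isContr (Π A B))
  funext-weak {i} {j} {A} {B} c =
    subst (λ B → El (isContr (Π A B))) (decode-lam B)
      (transport (λ Z → isContr (Π A (decode ∘ app Z))) (funext-nondep (contr⇒Id-Unit ∘ c))
        (subst (λ B → El (isContr (Π A B))) (sym (decode-lam (const (Unit j)))) Unit-contr))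
    where
    decode-lam : (B : El A → U j) → decode ∘ app (lam (code ∘ B)) ≡ B
    decode-lam B = funextᵉ λ a →
      trans (cong decode (cong-app (app-lam (code ∘ B)) a)) (decode-code (B a))

    Unit-contr : El (isContr (A ⇒ Unit j))
    Unit-contr = mkContr (lam (const ⋆)) λ g →
      ≡⇒Id (trans (cong lam (funextᵉ λ a → Unit-η (app g a))) (lam-app g))

  -- The product of the singletons `S a` at `g a` is contractible by `funext-weak`. Both `f` with
  -- `h` and `g` with `idp` are points of it, and `restrict` projects them back to `f` and `g`.
  funext : {A : U i} {B : El A → U j} {f g : ∀ a → El (B a)} →
           (∀ a → El (Id (B a) (f a) (g a))) → El (Id (Π A B) (lam f) (lam g))
  funext {i} {j} {A} {B} {f} {g} h =
    subst (λ u → El (Id (Π A B) u (lam g))) (restrict-lam f h)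
      (subst (λ u → El (Id (Π A B) (restrict (lam λ a → pair (f a) (h a))) u))
        (restrict-lam g (idp ∘ g))
        (ap restrict (contr⇒Id (funext-weak λ a → app (id-isEquiv (B a)) (g a)) _ _)))
    where
    S : El A → U j
    S a = fib {A = B a} {B a} id (g a)

    restrict : El (Π A S) → El (Π A B)
    restrict u = lam λ a → fst (app u a)

    restrict-lam : (f : ∀ a → El (B a)) (h : ∀ a → El (Id (B a) (f a) (g a))) →
                   restrict (lam λ a → pair (f a) (h a)) ≡ lam f
    restrict-lam f h = cong lam (funextᵉ λ a →
      trans (cong fst (cong-app (app-lam (λ a → pair (f a) (h a))) a)) (fst-pair (f a) (h a)))

  -- Equivalences from a strict section.

  -- The fibre of f over b is a retract of the fibre of g ∘ f over g b, and g ∘ f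
  -- is an equivalence because it equals id; no triangle identity is needed.
  split⇒isEquiv : {A : U i} {B : U j} (f : El A → El B) (g : El B → El A) →
                  (∀ b → f (g b) ≡ b) → (∀ a → El (Id A a (g (f a)))) →
                  El (isEquiv {A = A} {B} f)
  split⇒isEquiv {i} {j} {A} {B} f g fg gf = lam λ b →
    contr-retract
      (on-fib b)
      (off-fib b)
      (Sg-elim (λ v → Id (fib f b) (off-fib b (on-fib b v)) v)
        λ a p → subst (λ v → El (Id (fib f b) v (pair a p)))
          (sym (trans (cong (off-fib b) (Sg-elim-pair (λ _ → fib (g ∘ f) (g b)) (λ a p → pair a (ap g p)) a p))
                      (Sg-elim-pair (λ _ → fib f b) (λ a q → pair a (back q)) a (ap g p))))
          (ap (pair a) (back-ap p)))
      (app gf-isEquiv (g b))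
    where
    -- A left inverse of `ap g`: apply `f`, then correct both endpoints by the strict law `fg`.
    back : ∀ {b b′} → El (Id A (g b) (g b′)) → El (Id B b b′)
    back {b} {b′} q = subst (λ x → El (Id B x b′)) (fg b)
                        (subst (λ y → El (Id B (f (g b)) y)) (fg b′) (ap f q))

    back-idp : ∀ b → back (idp (g b)) ≡ idp b
    back-idp b rewrite J-idp (λ x _ → Id B (f (g b)) (f x)) (idp (f (g b))) = aux (fg b)
      where
      aux : ∀ {x b} (p : x ≡ b) →
            subst (λ x → El (Id B x b)) p (subst (λ y → El (Id B x y)) p (idp x)) ≡ idp b
      aux refl = refl

    back-ap : ∀ {b b′} (p : El (Id B b b′)) → El (Id (Id B b b′) (back (ap g p)) p)
    back-ap {b} = J (λ b′ p → Id (Id B b b′) (back (ap g p)) p)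
      (≡⇒Id (trans (cong back (J-idp _ _)) (back-idp b)))

    on-fib : ∀ b → El (fib {A = A} {B} f b) → El (fib {A = A} {A} (g ∘ f) (g b))
    on-fib b = Sg-elim (λ _ → fib (g ∘ f) (g b)) λ a p → pair a (ap g p)

    off-fib : ∀ b → El (fib {A = A} {A} (g ∘ f) (g b)) → El (fib {A = A} {B} f b)
    off-fib b = Sg-elim (λ _ → fib f b) λ a q → pair a (back q)

    gf-isEquiv : El (isEquiv {A = A} {A} (g ∘ f))
    gf-isEquiv = subst (λ e → El (isEquiv {A = A} {A} e)) (app-lam (g ∘ f))
      (transport (λ e → isEquiv {A = A} {A} (app e)) (funext gf)
        (subst (λ e → El (isEquiv {A = A} {A} e)) (sym (app-lam id)) (id-isEquiv A)))

  -- Fibrant exo-types and inner induction into them.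

  fibrant-Π : {A : Set i} {B : A → Set j} → IsFibrant T A → (∀ a → IsFibrant T (B a)) →
              IsFibrant T (∀ a → B a)
  fibrant-Π {A = A} {B} FA FB = record
    { match = Π (match FA) λ x → match (FB (from (iso FA) x))
    ; iso   = record
      { to      = λ f → lam λ x → to (iso (FB _)) (f (from (iso FA) x))
      ; from    = λ g a → subst B (cong-app (from∘to (iso FA)) a)
                            (from (iso (FB _)) (app g (to (iso FA) a)))
      ; to∘from = funextᵉ λ g → trans (cong lam (funextᵉ λ x →
                    to-from g (cong-app (to∘from (iso FA)) x) _)) (lam-app g)
      ; from∘to = funextᵉ λ f → funextᵉ λ a → trans
                    (cong (λ h → subst B (cong-app (from∘to (iso FA)) a)
                                   (from (iso (FB _)) (h (to (iso FA) a))))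
                          (app-lam (λ x → to (iso (FB _)) (f (from (iso FA) x)))))
                    (from-to f (cong-app (from∘to (iso FA)) a))
      }
    }
    where
    to-from : ∀ g {x y} → y ≡ x → (q : from (iso FA) y ≡ from (iso FA) x) →
              to (iso (FB _)) (subst B q (from (iso (FB _)) (app g y))) ≡ app g x
    to-from g refl refl = cong-app (to∘from (iso (FB _))) _

    from-to : ∀ f {a b} (q : a ≡ b) →
              subst B q (from (iso (FB a)) (to (iso (FB a)) (f a))) ≡ f b
    from-to f refl = cong-app (from∘to (iso (FB _))) _

  module _ {P : El N → Set j} (FP : ∀ n → IsFibrant T (P n))
           (z : P zeroᴺ) (s : ∀ n → P n → P (sucᴺ n)) where
    private
      z′ : El (match (FP zeroᴺ))
      z′ = to (iso (FP _)) z

      s′ : ∀ n → El (match (FP n)) → El (match (FP (sucᴺ n)))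
      s′ n p = to (iso (FP _)) (s n (from (iso (FP n)) p))

    -- `N` eliminates only into types, so the recursion runs in the fibrant matches and is carried
    -- back along the isomorphisms.
    N-elim-fibrant : ∀ n → P n
    N-elim-fibrant n = from (iso (FP n)) (N-elim (λ n → match (FP n)) z′ s′ n)

    N-elim-fibrant-zero : N-elim-fibrant zeroᴺ ≡ z
    N-elim-fibrant-zero =
      trans (cong (from (iso (FP _))) (N-zero _ z′ s′)) (cong-app (from∘to (iso (FP _))) z)

    N-elim-fibrant-suc : ∀ n → N-elim-fibrant (sucᴺ n) ≡ s n (N-elim-fibrant n)
    N-elim-fibrant-suc n =
      trans (cong (from (iso (FP _))) (N-suc _ z′ s′ n)) (cong-app (from∘to (iso (FP _))) _)

  -- Sharpness of the exo-natural numbers.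

  ι : ℕ → El N
  ι zero    = zeroᴺ
  ι (suc n) = sucᴺ (ι n)

  module _ (C : IsCofibrant T ℕ) (Y : El N → U j) where
    -- Quantifying over the reindexing s lets the inner recursion on n consume the
    -- exo-sequence y by shifting it; cofibrancy of ℕ makes the type of y fibrant.
    Evaluation : El N → Set j
    Evaluation n = (s : El N → El N) → ((m : ℕ) → El (Y (s (ι m)))) → El (Y (s n))

    evaluation-fibrant : ∀ n → IsFibrant T (Evaluation n)
    evaluation-fibrant n =
      fibrant-Π (fibrant-Π (type-fibrant T N) λ _ → type-fibrant T N) λ s →
      fibrant-Π (Π-fibrant C (λ m → Y (s (ι m)))) λ _ → type-fibrant T (Y (s n))

    evaluate-zero : Evaluation zeroᴺ
    evaluate-zero s y = y zero

    evaluate-suc : ∀ n → Evaluation n → Evaluation (sucᴺ n)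
    evaluate-suc n e s y = e (s ∘ sucᴺ) (y ∘ suc)

    evaluate : ∀ n → Evaluation n
    evaluate = N-elim-fibrant evaluation-fibrant evaluate-zero evaluate-suc

    -- Each successor in `ι k` shifts the sequence once, so its head after `k` shifts is `y k`.
    evaluate-ι : ∀ k s y → evaluate (ι k) s y ≡ y k
    evaluate-ι zero    s y =
      cong (λ e → e s y) (N-elim-fibrant-zero evaluation-fibrant evaluate-zero evaluate-suc)
    evaluate-ι (suc k) s y = trans
      (cong (λ e → e s y)
        (N-elim-fibrant-suc evaluation-fibrant evaluate-zero evaluate-suc (ι k)))
      (evaluate-ι k (s ∘ sucᴺ) (y ∘ suc))

    -- Stated with `Id`, the claim is fibrant and open to inner induction. A shifted restriction
    -- along `s` is the restriction along `s ∘ sucᴺ`, where the induction hypothesis applies.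
    evaluate-restriction : (g : ∀ n → El (Y n)) → ∀ n (s : El N → El N) →
                           El (Id (Y (s n)) (g (s n)) (evaluate n s (λ m → g (s (ι m)))))
    evaluate-restriction g = N-elim-fibrant
      (λ n → fibrant-Π (fibrant-Π (type-fibrant T N) λ _ → type-fibrant T N) λ s →
        type-fibrant T _)
      (λ s → ≡⇒Id (sym (evaluate-ι zero s _)))
      (λ n e s → subst (λ x → El (Id _ _ x))
        (sym (cong (λ e → e s (λ m → g (s (ι m))))
          (N-elim-fibrant-suc evaluation-fibrant evaluate-zero evaluate-suc n)))
        (e (s ∘ sucᴺ)))

    ι-precomp-equiv : IsFibrantEquiv T (type-fibrant T (Π N Y)) (Π-fibrant C (λ m → Y (ι m)))
                                     (precomp T ι Y)
    ι-precomp-equiv = split⇒isEquiv _ extend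
      (λ x → trans (cong (to F) (funextᵉ λ m →
                     trans (cong-app (app-lam _) (ι m)) (evaluate-ι m id _)))
                   (cong-app (to∘from F) x))
      (λ g → subst (λ u → El (Id (Π N Y) u (extend (to F (precomp T ι Y g))))) (lam-app g)
        (funext λ n → subst (λ y → El (Id (Y n) (app g n) (evaluate n id y)))
          (sym (cong-app (from∘to F) _)) (evaluate-restriction (app g) n id)))
      where
      F : ((m : ℕ) → El (Y (ι m))) ≅ El (match (Π-fibrant C (λ m → Y (ι m))))
      F = iso (Π-fibrant C (λ m → Y (ι m)))

      extend : El (match (Π-fibrant C (λ m → Y (ι m)))) → El (Π N Y)
      extend x = lam λ n → evaluate n id (from F x)

  ℕ-sharp : IsCofibrant T ℕ → IsSharp T ℕ
  ℕ-sharp C = record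
    { cofibrant = C ; RA = N ; r = ι ; precomp-equiv = ι-precomp-equiv C }

  -- Transfer along exo-isomorphisms.

  module _ {A B : Set i} (A≅B : A ≅ B) where
    reindex : (Y : A → Set j) → (∀ a → Y a) ≅ (∀ b → Y (from A≅B b))
    reindex Y = record
      { to      = λ f b → f (from A≅B b)
      ; from    = λ g a → subst Y (cong-app (from∘to A≅B) a) (g (to A≅B a))
      ; to∘from = funextᵉ λ g → funextᵉ λ b → shift g (cong-app (to∘from A≅B) b) _
      ; from∘to = funextᵉ λ f → funextᵉ λ a → unshift f (cong-app (from∘to A≅B) a)
      }
      where
      shift : ∀ g {b b′} → b′ ≡ b → (q : from A≅B b′ ≡ from A≅B b) → subst Y q (g b′) ≡ g b
      shift g refl refl = refl

      unshift : ∀ f {a a′} (q : a′ ≡ a) → subst Y q (f a′) ≡ f a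
      unshift f refl = refl

    cofibrant-≅ : IsCofibrant T B → IsCofibrant T A
    cofibrant-≅ C = record
      { Π-fibrant = λ Y → record
          { match = match (Π-fibrant C (Y ∘ from A≅B))
          ; iso   = ≅-trans (reindex (El ∘ Y)) (iso (Π-fibrant C (Y ∘ from A≅B)))
          }
      ; Π-contr   = λ Y c → Π-contr C (Y ∘ from A≅B) (c ∘ from A≅B)
      }
      where
      ≅-trans : ∀ {j k l} {X : Set j} {Y : Set k} {Z : Set l} → X ≅ Y → Y ≅ Z → X ≅ Z
      ≅-trans e f = record
        { to      = to f ∘ to e
        ; from    = from e ∘ from f
        ; to∘from = trans (cong (λ h → to f ∘ h ∘ from f) (to∘from e)) (to∘from f)
        ; from∘to = trans (cong (λ h → from e ∘ h ∘ to e) (from∘to f)) (from∘to e)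
        }

    -- After reindexing over `B`, precomposition is along `r S ∘ to A≅B ∘ from A≅B`, which is
    -- exo-equal to `r S`.
    sharp-≅ : IsSharp T B → IsSharp T A
    sharp-≅ S = record
      { cofibrant     = cofibrant-≅ (cofibrant S)
      ; RA            = RA S
      ; r             = r S ∘ to A≅B
      ; precomp-equiv = λ Y →
          subst (λ r′ → IsFibrantEquiv T (type-fibrant T (Π (RA S) Y))
                          (Π-fibrant (cofibrant S) (Y ∘ r′)) (precomp T r′ Y))
            (sym (cong (r S ∘_) (to∘from A≅B))) (precomp-equiv S Y)
      }

corollary3p9 : (T : TwoLevelTypeTheory) → IsCofibrant T ℕ →
    IsCofibrant T UnLBinTreeᵉ ×ω IsSharp T UnLBinTreeᵉ
corollary3p9 T C = cofibrant-≅ T (tree≅ℕ T) C ,ω sharp-≅ T (tree≅ℕ T) (ℕ-sharp T C)
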